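{- Let $\mathcal G=(V,\mathcal E)$ be a temporal graph, $n=|V|$, let $(\star)$ be one of the optimality criteria shortest, shortest-foremost, prefix-foremost, and let $\mathcal D=\mathbb{TP}^{(\star)}_{\mathcal G}$ be the (disjoint) union over all ordered pairs $s\ne z$ of the sets $\Gamma^{(\star)}_{sz}$. Let $tp_{sz}\in\mathcal D$ be sampled according to the probability function $\pi(tp_{sz})=\frac1{n(n-1)}\frac1{\sigma^{(\star)}_{sz}}$, and for $v\in V$ let $\widetilde b^{(\star)}(v\mid tp_{sz})=\mathds 1[v\in\mathbf{Int}(tp_{sz})]$. Then $\mathbf E[\widetilde b^{(\star)}(v\mid tp_{sz})]=\mathtt b^{(\star)}_v$ for every $v\in V$.
   Context: A (directed) temporal graph is $\mathcal G=(V,\mathcal E)$ with $V$ finite, $n=|V|\ge2$, and $\mathcal E$ a finite set of temporal edges $(u,v,t)$, $u,v\in V$, $t\in T=\{1,\dots,|T|\}$. A temporal path from $s$ to $z\ne s$ is a sequence of vertex appearances $((u_1,t_1),\dots,(u_k,t_k))$ with $u_1=s$, $u_k=z$, $t_1=0$, $t_i<t_{i+1}$ and $(u_i,u_{i+1},t_{i+1})\in\mathcal E$. Its length is $k-1$, its arrival time $t_k$; $\mathbf{Int}(tp)$ is the set of its appearances other than the first and last, and $v\in\mathbf{Int}(tp)$ means $(v,t)\in\mathbf{Int}(tp)$ for some $t$. It is foremost if no temporal path from $s$ to $z$ arrives earlier (the trivial path from $s$ to itself arrives at time $0$). $(\star)$-optimal means: shortest (minimum length), shortest-foremost (minimum length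 among foremost paths), or prefix-foremost (foremost with every prefix foremost). $\Gamma^{(\star)}_{sz}$ is the set of $(\star)$-optimal temporal paths from $s$ to $z$ and $\sigma^{(\star)}_{sz}=|\Gamma^{(\star)}_{sz}|$. Convention: if no temporal path from $s$ to $z$ exists, $\Gamma^{(\star)}_{sz}$ consists of a single empty path $tp_\emptyset$ (a separate copy for each such pair, with $\mathbf{Int}(tp_\emptyset)=\emptyset$), and $\sigma^{(\star)}_{sz}=1$. For $v\notin\{s,z\}$, $\sigma^{(\star)}_{sz}(v)$ is the number of paths in $\Gamma^{(\star)}_{sz}$ passing through $v$. The $(\star)$-temporal betweenness is $\mathtt b^{(\star)}_v=\frac1{n(n-1)}\sum_{s\ne v\ne z,\ s\ne z}\sigma^{(\star)}_{sz}(v)/\sigma^{(\star)}_{sz}$. -}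

module Defs where

open import Data.Fin.Base using (Fin)
import Data.Fin.Properties as Fin
open import Data.Integer.Base as ℤ using (+_)
import Data.Integer.Properties as ℤ
open import Data.List.Base as List using (List; []; _∷_; _++_; head; last; length; map; concatMap; filter; take; drop; foldr; allFin; upTo; cartesianProduct; cartesianProductWith)
open import Data.List.Extrema.Nat using (argmin; argmin-all; f[argmin]≤f[xs])
open import Data.List.Membership.Propositional using (_∈_; find; lose)
open import Data.List.Membership.Propositional.Properties using (∈-allFin; ∈-upTo⁺; ∈-cartesianProduct⁺; ∈-cartesianProductWith⁺; ∈-cartesianProductWith⁻; ∈-filter⁺; ∈-filter⁻; ∈-map⁻; ∈-length)
import Data.List.Membership.DecPropositional as DecMembership
open import Data.List.Properties using (filter-all; filter-accept; filter-reject; filter-++; length-++; length-tabulate)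
open import Data.List.Relation.Binary.Disjoint.Propositional using (Disjoint)
open import Data.List.Relation.Binary.Prefix.Heterogeneous using (Prefix; []; _∷_)
open import Data.List.Relation.Binary.Prefix.Heterogeneous.Properties using (prefix?)
open import Data.List.Relation.Unary.All as All using (All; []; _∷_; all?)
import Data.List.Relation.Unary.All.Properties as All
open import Data.List.Relation.Unary.AllPairs as AllPairs using ([]; _∷_)
import Data.List.Relation.Unary.AllPairs.Properties as AllPairs
open import Data.List.Relation.Unary.Any using (here; there; any?)
open import Data.List.Relation.Unary.Linked as Linked using (Linked; []; [-]; _∷_; linked?)
open import Data.List.Relation.Unary.Unique.Propositional using (Unique)
import Data.List.Relation.Unary.Unique.Propositional.Properties as Unique
open import Data.Maybe.Base as Maybe using (just; maybe′)
import Data.Maybe.Properties as Maybe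
open import Data.Nat.Base as ℕ using (ℕ; zero; suc; _∸_; _≤_; _<_; z≤n; s≤s; NonZero)
import Data.Nat.Properties as ℕ
open import Data.Product.Base using (_×_; _,_; ∃; proj₁; proj₂; uncurry)
import Data.Product.Properties as Product
open import Data.Rational.Base as ℚ using (ℚ; 0ℚ; 1ℚ; _/_; toℚᵘ)
import Data.Rational.Properties as ℚ
import Data.Rational.Unnormalised.Base as ℚᵘ
import Data.Rational.Unnormalised.Properties as ℚᵘ
open import Data.Sum.Base using (_⊎_; inj₁; inj₂)
open import Function.Base using (_∘_; case_of_)
open import Relation.Binary.PropositionalEquality using (_≡_; _≢_; refl; sym; trans; cong; cong₂; subst; module ≡-Reasoning)
open import Relation.Nullary using (Dec; yes; no; ¬_; ¬?; does; contradiction)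
open import Relation.Nullary.Decidable using (map′; _×-dec_; _→-dec_)
open import Relation.Unary using (Decidable)
open import Data.Bool.Base using (if_then_else_)

private variable
  A B : Set

∑ : List A → (A → ℚ) → ℚ
∑ xs f = foldr (λ x q → f x ℚ.+ q) 0ℚ xs

𝟙[_] : {P : Set} → Dec P → ℚ
𝟙[ P? ] = if does P? then 1ℚ else 0ℚ

record Distribution (A : Set) : Set where
  field
    support : List A
    unique  : Unique support
    mass    : A → ℚ
    mass≥0  : ∀ x → x ∈ support → 0ℚ ℚ.≤ mass x
    total   : ∑ support mass ≡ 1ℚ

𝔼 : Distribution A → (A → ℚ) → ℚ
𝔼 D f = ∑ support (λ x → mass x ℚ.* f x)
  where open Distribution D

∑-cong : ∀ (xs : List A) {f g : A → ℚ} → (∀ x → x ∈ xs → f x ≡ g x) → ∑ xs f ≡ ∑ xs g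
∑-cong []       eq = refl
∑-cong (x ∷ xs) eq = cong₂ ℚ._+_ (eq x (here refl)) (∑-cong xs (λ y → eq y ∘ there))

∑-++ : ∀ (xs ys : List A) (f : A → ℚ) → ∑ (xs ++ ys) f ≡ ∑ xs f ℚ.+ ∑ ys f
∑-++ []       ys f = sym (ℚ.+-identityˡ _)
∑-++ (x ∷ xs) ys f = trans (cong (f x ℚ.+_) (∑-++ xs ys f)) (sym (ℚ.+-assoc (f x) _ _))

∑-map : ∀ (g : A → B) (xs : List A) (f : B → ℚ) → ∑ (map g xs) f ≡ ∑ xs (f ∘ g)
∑-map g []       f = refl
∑-map g (x ∷ xs) f = cong (f (g x) ℚ.+_) (∑-map g xs f)

∑-concatMap : ∀ (g : A → List B) (xs : List A) (f : B → ℚ) →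
              ∑ (concatMap g xs) f ≡ ∑ xs (λ x → ∑ (g x) f)
∑-concatMap g []       f = refl
∑-concatMap g (x ∷ xs) f =
  trans (∑-++ (g x) (concatMap g xs) f) (cong (∑ (g x) f ℚ.+_) (∑-concatMap g xs f))

suc/1 : ∀ k → + suc k / 1 ≡ 1ℚ ℚ.+ + k / 1
suc/1 k = ℚ.toℚᵘ-injective (begin-equality
  toℚᵘ (+ suc k / 1)                  ≃⟨ ℚ.toℚᵘ-fromℚᵘ (ℚᵘ.mkℚᵘ (+ suc k) 0) ⟩
  ℚᵘ.mkℚᵘ (+ suc k) 0                 ≃⟨ ℚᵘ.*≡* (cong (λ x → (ℤ.1ℤ ℤ.+ x) ℤ.* ℤ.1ℤ) (sym (ℤ.*-identityʳ (+ k)))) ⟩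
  ℚᵘ.1ℚᵘ ℚᵘ.+ ℚᵘ.mkℚᵘ (+ k) 0         ≃⟨ ℚᵘ.+-congʳ ℚᵘ.1ℚᵘ (ℚ.toℚᵘ-fromℚᵘ (ℚᵘ.mkℚᵘ (+ k) 0)) ⟨
  toℚᵘ 1ℚ ℚᵘ.+ toℚᵘ (+ k / 1)         ≃⟨ ℚ.toℚᵘ-homo-+ 1ℚ (+ k / 1) ⟨
  toℚᵘ (1ℚ ℚ.+ + k / 1)               ∎)
  where open ℚᵘ.≤-Reasoning

m*1/m : ∀ m .{{_ : NonZero m}} → + m / 1 ℚ.* (+ 1 / m) ≡ 1ℚ
m*1/m (suc k) = ℚ.toℚᵘ-injective (begin-equality
  toℚᵘ (+ suc k / 1 ℚ.* (+ 1 / suc k))        ≃⟨ ℚ.toℚᵘ-homo-* (+ suc k / 1) (+ 1 / suc k) ⟩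
  toℚᵘ (+ suc k / 1) ℚᵘ.* toℚᵘ (+ 1 / suc k)  ≃⟨ ℚᵘ.*-cong (ℚ.toℚᵘ-fromℚᵘ (ℚᵘ.mkℚᵘ (+ suc k) 0)) (ℚ.toℚᵘ-fromℚᵘ (ℚᵘ.mkℚᵘ (+ 1) k)) ⟩
  ℚᵘ.mkℚᵘ (+ suc k) 0 ℚᵘ.* ℚᵘ.mkℚᵘ (+ 1) k    ≃⟨ ℚᵘ.*-inverseʳ (ℚᵘ.mkℚᵘ (+ suc k) 0) ⟩
  ℚᵘ.1ℚᵘ                                      ∎)
  where open ℚᵘ.≤-Reasoning

1/m≥0 : ∀ m .{{_ : NonZero m}} → ℚ.NonNegative (+ 1 / m)
1/m≥0 m = ℚ.normalize-nonNeg 1 m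

∑-const : ∀ (xs : List A) (c : ℚ) → ∑ xs (λ _ → c) ≡ + length xs / 1 ℚ.* c
∑-const []       c = sym (ℚ.*-zeroˡ c)
∑-const (x ∷ xs) c = begin
  c ℚ.+ ∑ xs (λ _ → c)                  ≡⟨ cong₂ ℚ._+_ (sym (ℚ.*-identityˡ c)) (∑-const xs c) ⟩
  1ℚ ℚ.* c ℚ.+ + length xs / 1 ℚ.* c    ≡⟨ ℚ.*-distribʳ-+ c 1ℚ (+ length xs / 1) ⟨
  (1ℚ ℚ.+ + length xs / 1) ℚ.* c        ≡⟨ cong (ℚ._* c) (suc/1 (length xs)) ⟨
  + suc (length xs) / 1 ℚ.* c           ∎
  where open ≡-Reasoning

listsUpTo : ℕ → List A → List (List A)
listsUpTo zero    as = [] ∷ []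
listsUpTo (suc k) as = [] ∷ cartesianProductWith List._∷_ as (listsUpTo k as)

∈-listsUpTo : ∀ {k} {as xs : List A} → length xs ≤ k → All (_∈ as) xs → xs ∈ listsUpTo k as
∈-listsUpTo {k = zero}  z≤n      []         = here refl
∈-listsUpTo {k = suc k} z≤n      []         = here refl
∈-listsUpTo {k = suc k} (s≤s le) (x∈ ∷ xs∈) =
  there (∈-cartesianProductWith⁺ List._∷_ x∈ (∈-listsUpTo le xs∈))

listsUpTo-unique : ∀ k {as : List A} → Unique as → Unique (listsUpTo k as)
listsUpTo-unique zero    u = [] ∷ []
listsUpTo-unique (suc k) {as} u =
  All.tabulate (λ x∈ → nonempty as (listsUpTo k as) x∈)
  ∷ Unique.cartesianProductWith⁺ List._∷_ (λ { refl → refl , refl }) u (listsUpTo-unique k u)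
  where
  nonempty : ∀ (as : List A) ass {x} → x ∈ cartesianProductWith List._∷_ as ass → [] ≢ x
  nonempty as ass x∈ with ∈-cartesianProductWith⁻ List._∷_ as ass x∈
  ... | _ , _ , _ , _ , refl = λ ()

-- `edges` is read as a finite set: only membership in it is ever used.
record TemporalGraph : Set where
  field
    n     : ℕ
    n≥2   : 2 ≤ n
    T     : ℕ
    edges : List (Fin n × Fin n × ℕ)
    times : All (λ (_ , _ , t) → 1 ≤ t × t ≤ T) edges

  V : Set
  V = Fin n

  Appearance : Set
  Appearance = V × ℕ

open TemporalGraph using (V)

data Criterion : Set where
  shortest shortestForemost prefixForemost : Criterion

module _ (G : TemporalGraph) where
  open TemporalGraph G hiding (V)

  private
    W = V G
    variable
      s z u v   : W
      tp tp′ p q : List Appearance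

  Step : Appearance → Appearance → Set
  Step (u , t) (v , t′) = t < t′ × (u , v , t′) ∈ edges

  -- The case z = s is admitted: it is needed for the prefixes of a path,
  -- and it contains the trivial path (s , 0) ∷ [].
  IsTemporalPath : W → W → List Appearance → Set
  IsTemporalPath s z tp =
    head tp ≡ just (s , 0) × Linked Step tp × Maybe.map proj₁ (last tp) ≡ just z

  pathLength : List Appearance → ℕ
  pathLength tp = length tp ∸ 1

  arrival : List Appearance → ℕ
  arrival tp = maybe′ proj₂ 0 (last tp)

  Int : List Appearance → List Appearance
  Int tp = drop 1 (take (length tp ∸ 1) tp)

  _∈ⱽ_ : W → List Appearance → Set
  v ∈ⱽ as = ∃ λ t → (v , t) ∈ as

  Foremost : W → W → List Appearance → Set
  Foremost s z tp = IsTemporalPath s z tp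
    × (∀ tp′ → IsTemporalPath s z tp′ → arrival tp ≤ arrival tp′)

  Shortest : W → W → List Appearance → Set
  Shortest s z tp = IsTemporalPath s z tp
    × (∀ tp′ → IsTemporalPath s z tp′ → pathLength tp ≤ pathLength tp′)

  ShortestForemost : W → W → List Appearance → Set
  ShortestForemost s z tp = Foremost s z tp
    × (∀ tp′ → Foremost s z tp′ → pathLength tp ≤ pathLength tp′)

  -- IsTemporalPath s u p only discards the empty prefix and fixes u as the
  -- last vertex of p.
  PrefixForemost : W → W → List Appearance → Set
  PrefixForemost s z tp = Foremost s z tp
    × (∀ u p → IsTemporalPath s u p → Prefix _≡_ p tp → Foremost s u p)

  Optimal : Criterion → W → W → List Appearance → Set
  Optimal shortest         = Shortest
  Optimal shortestForemost = ShortestForemost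
  Optimal prefixForemost   = PrefixForemost

  Reachable : W → W → Set
  Reachable s z = ∃ λ tp → IsTemporalPath s z tp

  _≟ᴬ_ : (a b : Appearance) → Dec (a ≡ b)
  _≟ᴬ_ = Product.≡-dec (Fin._≟_ {n}) ℕ._≟_

  open DecMembership (Product.≡-dec (Fin._≟_ {n}) _≟ᴬ_) using (_∈?_)

  step? : ∀ a b → Dec (Step a b)
  step? (u , t) (v , t′) = (t ℕ.<? t′) ×-dec ((u , v , t′) ∈? edges)

  isTemporalPath? : ∀ s z → Decidable (IsTemporalPath s z)
  isTemporalPath? s z tp = Maybe.≡-dec _≟ᴬ_ (head tp) (just (s , 0))
    ×-dec linked? step? tp
    ×-dec Maybe.≡-dec Fin._≟_ (Maybe.map proj₁ (last tp)) (just z)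

  _∈ⱽ?_ : ∀ v as → Dec (v ∈ⱽ as)
  v ∈ⱽ? as = map′ to from (any? (λ a → v Fin.≟ proj₁ a) as)
    where
    to   = λ i → case find i of λ { ((_ , t) , a∈ , refl) → t , a∈ }
    from = λ (t , a∈) → lose a∈ refl

  -- Appearance times are strictly increasing and at most T, so a temporal path
  -- has at most T + 1 appearances.
  appearances : List Appearance
  appearances = cartesianProduct (allFin n) (upTo (suc T))

  temporalPaths : W → W → List (List Appearance)
  temporalPaths s z = filter (isTemporalPath? s z) (listsUpTo (suc T) appearances)

  private
    times-≤ : ∀ {t} → (u , v , t) ∈ edges → t ≤ T
    times-≤ e∈ = proj₂ (All.lookup times e∈)

    linked-bounds : ∀ {a as} → proj₂ a ≤ T → Linked Step (a ∷ as) →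
                    length as ℕ.+ proj₂ a ≤ T × All (_∈ appearances) (a ∷ as)
    linked-bounds {a} a≤T l = go a≤T l
      where
      mem : ∀ {a} → proj₂ a ≤ T → a ∈ appearances
      mem a≤T = ∈-cartesianProduct⁺ (∈-allFin _) (∈-upTo⁺ (s≤s a≤T))
      go : ∀ {a as} → proj₂ a ≤ T → Linked Step (a ∷ as) →
           length as ℕ.+ proj₂ a ≤ T × All (_∈ appearances) (a ∷ as)
      go a≤T [-] = a≤T , mem a≤T ∷ []
      go {_ , t} {(_ , t′) ∷ as} a≤T ((t<t′ , e∈) ∷ l) with go (times-≤ e∈) l
      ... | le , as∈ =
        ℕ.≤-trans (ℕ.≤-reflexive (sym (ℕ.+-suc (length as) t)))
          (ℕ.≤-trans (ℕ.+-monoʳ-≤ (length as) t<t′) le)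
        , mem a≤T ∷ as∈

  ∈-temporalPaths : IsTemporalPath s z tp → tp ∈ temporalPaths s z
  ∈-temporalPaths {s} {z} {a ∷ as} path@(refl , l , _) with linked-bounds z≤n l
  ... | le , as∈ = ∈-filter⁺ (isTemporalPath? s z)
    (∈-listsUpTo (s≤s (ℕ.≤-trans (ℕ.m≤m+n (length as) 0) le)) as∈) path

  temporalPaths-path : ∀ s z → tp ∈ temporalPaths s z → IsTemporalPath s z tp
  temporalPaths-path s z tp∈ =
    proj₂ (∈-filter⁻ (isTemporalPath? s z) {xs = listsUpTo (suc T) appearances} tp∈)

  temporalPaths-unique : ∀ s z → Unique (temporalPaths s z)
  temporalPaths-unique s z = Unique.filter⁺ (isTemporalPath? s z)
    (listsUpTo-unique (suc T) (Unique.cartesianProduct⁺ (Unique.allFin⁺ n) (Unique.upTo⁺ (suc T))))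

  ∀path? : ∀ s z {P : List Appearance → Set} → Decidable P →
           Dec (∀ tp → IsTemporalPath s z tp → P tp)
  ∀path? s z P? = map′
    (λ all tp path → All.lookup all (∈-temporalPaths path))
    (λ f → All.tabulate (λ {tp} tp∈ → f tp (temporalPaths-path s z tp∈)))
    (all? P? (temporalPaths s z))

  reachable? : ∀ s z → Dec (Reachable s z)
  reachable? s z with temporalPaths s z in eq
  ... | []     = no λ (tp , path) → case subst (tp ∈_) eq (∈-temporalPaths path) of λ ()
  ... | tp ∷ _ = yes (tp , temporalPaths-path s z (subst (tp ∈_) (sym eq) (here refl)))

  foremost? : ∀ s z → Decidable (Foremost s z)
  foremost? s z tp = isTemporalPath? s z tp
    ×-dec ∀path? s z (λ tp′ → arrival tp ℕ.≤? arrival tp′)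

  shortest? : ∀ s z → Decidable (Shortest s z)
  shortest? s z tp = isTemporalPath? s z tp
    ×-dec ∀path? s z (λ tp′ → pathLength tp ℕ.≤? pathLength tp′)

  shortestForemost? : ∀ s z → Decidable (ShortestForemost s z)
  shortestForemost? s z tp = foremost? s z tp ×-dec map′
    (λ f tp′ fm → f tp′ (proj₁ fm) fm)
    (λ f tp′ _ → f tp′)
    (∀path? s z (λ tp′ → foremost? s z tp′ →-dec (pathLength tp ℕ.≤? pathLength tp′)))

  prefixForemost? : ∀ s z → Decidable (PrefixForemost s z)
  prefixForemost? s z tp = foremost? s z tp ×-dec
    Fin.all? (λ u → ∀path? s u (λ p → prefix? _≟ᴬ_ p tp →-dec foremost? s u p))

  optimal? : ∀ ⋆ s z → Decidable (Optimal ⋆ s z)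
  optimal? shortest         = shortest?
  optimal? shortestForemost = shortestForemost?
  optimal? prefixForemost   = prefixForemost?

  -- The empty list, which is not a temporal path, plays the role of tp_∅.
  Γ : Criterion → W → W → List (List Appearance)
  Γ ⋆ s z with reachable? s z
  ... | yes _ = filter (optimal? ⋆ s z) (temporalPaths s z)
  ... | no  _ = [] ∷ []

  σ : Criterion → W → W → ℕ
  σ ⋆ s z = length (Γ ⋆ s z)

  σ[_] : W → Criterion → W → W → ℕ
  σ[ v ] ⋆ s z = length (filter (v ∈ⱽ?_) (Γ ⋆ s z))

  optimal-path : ∀ ⋆ → Optimal ⋆ s z tp → IsTemporalPath s z tp
  optimal-path shortest         = proj₁
  optimal-path shortestForemost = proj₁ ∘ proj₁
  optimal-path prefixForemost   = proj₁ ∘ proj₁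

  ∈-Γ⁺ : ∀ ⋆ s z → Optimal ⋆ s z tp → tp ∈ Γ ⋆ s z
  ∈-Γ⁺ ⋆ s z opt with reachable? s z
  ... | yes _ = ∈-filter⁺ (optimal? ⋆ s z) (∈-temporalPaths (optimal-path ⋆ opt)) opt
  ... | no ¬r = contradiction (_ , optimal-path ⋆ opt) ¬r

  ∈-Γ⁻ : ∀ ⋆ s z → tp ∈ Γ ⋆ s z → Optimal ⋆ s z tp ⊎ (¬ Reachable s z × tp ≡ [])
  ∈-Γ⁻ ⋆ s z tp∈ with reachable? s z
  ... | yes _ = inj₁ (proj₂ (∈-filter⁻ (optimal? ⋆ s z) {xs = temporalPaths s z} tp∈))
  ∈-Γ⁻ ⋆ s z (here refl) | no ¬r = inj₂ (¬r , refl)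

  ∅∈Γ : ∀ ⋆ s z → ¬ Reachable s z → [] ∈ Γ ⋆ s z
  ∅∈Γ ⋆ s z ¬r with reachable? s z
  ... | yes r = contradiction r ¬r
  ... | no  _ = here refl

  Γ-unique : ∀ ⋆ s z → Unique (Γ ⋆ s z)
  Γ-unique ⋆ s z with reachable? s z
  ... | yes _ = Unique.filter⁺ (optimal? ⋆ s z) (temporalPaths-unique s z)
  ... | no  _ = [] ∷ []

  private
    minimise : ∀ {P : List Appearance → Set} (f : List Appearance → ℕ) → Decidable P →
               (∀ {tp} → P tp → IsTemporalPath s z tp) → P tp →
               ∃ λ tp → P tp × (∀ tp′ → P tp′ → f tp ≤ f tp′)
    minimise {s} {z} {tp} {P} f P? path Ptp =
      argmin f tp ps ,
      argmin-all f Ptp (All.all-filter P? (temporalPaths s z)) ,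
      λ tp′ Ptp′ → All.lookup (f[argmin]≤f[xs] {f = f} tp ps)
        (∈-filter⁺ P? (∈-temporalPaths (path Ptp′)) Ptp′)
      where ps = filter P? (temporalPaths s z)

    ∃foremost : Reachable s z → ∃ (Foremost s z)
    ∃foremost {s} {z} (_ , path) = minimise arrival (isTemporalPath? s z) (λ p → p) path

    trivial-foremost : ∀ s → Foremost s s ((s , 0) ∷ [])
    trivial-foremost s = (refl , [-] , refl) , λ _ _ → z≤n

    trivial : ∀ s → PrefixForemost s s ((s , 0) ∷ [])
    trivial s = trivial-foremost s , λ where
      u [] (() , _) _
      u (_ ∷ []) (_ , _ , refl) (refl ∷ []) → trivial-foremost s

    last-∷ʳ : ∀ (as : List Appearance) x → last (as ++ x ∷ []) ≡ just x
    last-∷ʳ []            x = refl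
    last-∷ʳ (_ ∷ [])      x = refl
    last-∷ʳ (_ ∷ a ∷ as)  x = last-∷ʳ (a ∷ as) x

    linked-∷ʳ : ∀ as {a b} → Linked Step as → last as ≡ just a → Step a b →
                Linked Step (as ++ b ∷ [])
    linked-∷ʳ (_ ∷ [])     [-]      refl st = st ∷ [-]
    linked-∷ʳ (_ ∷ _ ∷ as) (r ∷ rs) eq   st = r ∷ linked-∷ʳ (_ ∷ as) rs eq st

    unsnocᵖ : ∀ {a as b} → Linked Step (a ∷ as) → last (a ∷ as) ≡ just b →
              (a ≡ b) ⊎ (∃ λ bs → ∃ λ c →
                Linked Step (a ∷ bs) × last (a ∷ bs) ≡ just c × Step c b)
    unsnocᵖ [-]                    refl = inj₁ refl
    unsnocᵖ {as = _ ∷ []} (r ∷ rs) refl = inj₂ ([] , _ , [-] , refl , r)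
    unsnocᵖ {as = a′ ∷ _ ∷ _} (r ∷ rs) eq with unsnocᵖ rs eq
    ... | inj₁ refl                   = inj₂ ([] , _ , [-] , refl , r)
    ... | inj₂ (bs , c , l , eq′ , st) = inj₂ (a′ ∷ bs , c , r ∷ l , eq′ , st)

    prefix-∷ʳ : ∀ {x} q → Prefix _≡_ p (q ++ x ∷ []) → Prefix _≡_ p q ⊎ p ≡ q ++ x ∷ []
    prefix-∷ʳ []       []               = inj₁ []
    prefix-∷ʳ []       (refl ∷ [])      = inj₂ refl
    prefix-∷ʳ (a ∷ as) []               = inj₁ []
    prefix-∷ʳ (a ∷ as) (refl ∷ pre) with prefix-∷ʳ as pre
    ... | inj₁ pre′ = inj₁ (refl ∷ pre′)
    ... | inj₂ refl = inj₂ refl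

    path-last : IsTemporalPath s z tp → last tp ≡ just (z , arrival tp)
    path-last {tp = tp} (_ , _ , eq) with last tp
    path-last (_ , _ , refl) | just _ = refl

    extend : ∀ {t} → PrefixForemost s u q → Step (u , arrival q) (z , t) →
             (∀ tp′ → IsTemporalPath s z tp′ → t ≤ arrival tp′) →
             PrefixForemost s z (q ++ (z , t) ∷ [])
    extend {s} {u} {q@(_ ∷ _)} {z} {t} ((path@(hd , l , _) , _) , pre) st t-min =
      fm , λ u′ p path′ p≼ → case prefix-∷ʳ q p≼ of λ where
        (inj₁ p≼q)  → pre u′ p path′ p≼q
        (inj₂ refl) → subst (λ w → Foremost s w q′) (target (proj₂ (proj₂ path′))) fm
      where
      q′ = q ++ (z , t) ∷ []

      target : ∀ {w} → Maybe.map proj₁ (last q′) ≡ just w → z ≡ w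
      target eq = Maybe.just-injective
        (trans (cong (Maybe.map proj₁) (sym (last-∷ʳ q (z , t)))) eq)

      fm : Foremost s z q′
      fm = ( hd , linked-∷ʳ q l (path-last path) st
           , cong (Maybe.map proj₁) (last-∷ʳ q (z , t)) )
         , λ tp′ path′ → ℕ.≤-trans
             (ℕ.≤-reflexive (cong (maybe′ proj₂ 0) (last-∷ʳ q (z , t)))) (t-min tp′ path′)

    ∃prefixForemost : ∀ m → IsTemporalPath s z tp → arrival tp ≤ m → ∃ (PrefixForemost s z)
    ∃prefixForemost {s} {z} {tp} m path le with ∃foremost (_ , path)
    ... | a ∷ as , fpath@(refl , l , _) , min
      with unsnocᵖ l (path-last fpath)
    ... | inj₁ eq = subst (λ w → ∃ (PrefixForemost s w)) (cong proj₁ eq) (_ , trivial s)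
    ... | inj₂ (bs , (u , t) , l′ , eq , (t<t′ , e∈)) = go m le
      where
      path-u : IsTemporalPath s u ((s , 0) ∷ bs)
      path-u = refl , l′ , cong (Maybe.map proj₁) eq

      arr-u : arrival ((s , 0) ∷ bs) ≡ t
      arr-u = cong (maybe′ proj₂ 0) eq

      go : ∀ m → arrival tp ≤ m → ∃ (PrefixForemost s z)
      go zero    le′ = contradiction
        (ℕ.≤-trans t<t′ (ℕ.≤-trans (min _ path) le′)) λ ()
      go (suc m) le′ with ∃prefixForemost m path-u
        (ℕ.≤-trans (ℕ.≤-reflexive arr-u)
          (ℕ.≤-pred (ℕ.≤-trans t<t′ (ℕ.≤-trans (min _ path) le′))))
      ... | q , pf@((_ , q-min) , _) = _ , extend pf
        ( ℕ.≤-<-trans (ℕ.≤-trans (q-min _ path-u) (ℕ.≤-reflexive arr-u)) t<t′ , e∈) min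

  ∃optimal : ∀ ⋆ → Reachable s z → ∃ (Optimal ⋆ s z)
  ∃optimal {s} {z} shortest (_ , path) =
    minimise pathLength (isTemporalPath? s z) (λ p → p) path
  ∃optimal {s} {z} shortestForemost r =
    minimise pathLength (foremost? s z) proj₁ (proj₂ (∃foremost r))
  ∃optimal prefixForemost (_ , path) = ∃prefixForemost _ path ℕ.≤-refl

  instance
    σ-nonZero : ∀ {⋆ s z} → NonZero (σ ⋆ s z)
    σ-nonZero {⋆} {s} {z} with reachable? s z in eq
    ... | no  _ = _
    ... | yes r = ℕ.>-nonZero (∈-length (∈-filter⁺ (optimal? ⋆ s z)
      (∈-temporalPaths (optimal-path ⋆ opt)) opt))
      where opt = proj₂ (∃optimal ⋆ r)

    n[n-1]-nonZero : NonZero (n ℕ.* (n ∸ 1))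
    n[n-1]-nonZero = go n≥2
      where
      go : ∀ {m} → 2 ≤ m → NonZero (m ℕ.* (m ∸ 1))
      go (s≤s (s≤s _)) = _

  pairs : List (W × W)
  pairs = filter (λ (s , z) → ¬? (s Fin.≟ z)) (cartesianProduct (allFin n) (allFin n))

  betweenness : Criterion → W → ℚ
  betweenness ⋆ v = (+ 1 / (n ℕ.* (n ∸ 1))) ℚ.*
    ∑ (filter (λ (s , z) → ¬? (s Fin.≟ v) ×-dec ¬? (z Fin.≟ v)) pairs)
      (λ (s , z) → + σ[ v ] ⋆ s z / σ ⋆ s z)

  -- The pair of endpoints keeps the copies of the empty path distinct.
  Sample : Set
  Sample = W × W × List Appearance

  samplesOf : Criterion → W × W → List Sample
  samplesOf ⋆ (s , z) = map (λ tp → s , z , tp) (Γ ⋆ s z)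

  𝕋ℙ : Criterion → List Sample
  𝕋ℙ ⋆ = concatMap (samplesOf ⋆) pairs

  weight : Criterion → Sample → ℚ
  weight ⋆ (s , z , _) = (+ 1 / (n ℕ.* (n ∸ 1))) ℚ.* (+ 1 / σ ⋆ s z)

  private
    count-≢ : ∀ {m} (x : Fin m) {xs} → Unique xs → x ∈ xs →
              suc (length (filter (λ y → ¬? (x Fin.≟ y)) xs)) ≡ length xs
    count-≢ x {_ ∷ xs} (x∉ ∷ _) (here refl) = cong (suc ∘ length)
      (trans (filter-reject (λ y → ¬? (x Fin.≟ y)) (λ x≢x → x≢x refl))
             (filter-all (λ y → ¬? (x Fin.≟ y)) x∉))
    count-≢ x {y ∷ xs} (y∉ ∷ u) (there x∈) = trans
      (cong (suc ∘ length) (filter-accept (λ y → ¬? (x Fin.≟ y))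
        λ { refl → All.lookup y∉ x∈ refl }))
      (cong suc (count-≢ x u x∈))

    count-row : ∀ {m} (x : Fin m) ys →
                length (filter (λ (s , z) → ¬? (s Fin.≟ z)) (map (x ,_) ys))
                ≡ length (filter (λ y → ¬? (x Fin.≟ y)) ys)
    count-row x []       = refl
    count-row x (y ∷ ys) with x Fin.≟ y
    ... | yes _ = count-row x ys
    ... | no  _ = cong suc (count-row x ys)

    count-pairs : ∀ {m} (xs : List (Fin m)) →
                  length (filter (λ (s , z) → ¬? (s Fin.≟ z)) (cartesianProduct xs (allFin m)))
                  ≡ length xs ℕ.* (m ∸ 1)
    count-pairs []       = refl
    count-pairs {m} (x ∷ xs) = begin
      length (filter ≢? (row ++ rest))                    ≡⟨ cong length (filter-++ ≢? row rest) ⟩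
      length (filter ≢? row ++ filter ≢? rest)            ≡⟨ length-++ (filter ≢? row) ⟩
      length (filter ≢? row) ℕ.+ length (filter ≢? rest)  ≡⟨ cong₂ ℕ._+_ row≡ (count-pairs xs) ⟩
      (m ∸ 1) ℕ.+ length xs ℕ.* (m ∸ 1)                   ∎
      where
      open ≡-Reasoning
      ≢? = λ ((s , z) : Fin m × Fin m) → ¬? (s Fin.≟ z)
      row  = map (x ,_) (allFin m)
      rest = cartesianProduct xs (allFin m)
      row≡ : length (filter ≢? row) ≡ m ∸ 1
      row≡ = trans (count-row x (allFin m)) (cong (_∸ 1)
        (trans (count-≢ x (Unique.allFin⁺ m) (∈-allFin x)) (length-tabulate {n = m} (λ i → i))))

  length-pairs : length pairs ≡ n ℕ.* (n ∸ 1)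
  length-pairs = trans (count-pairs (allFin n))
    (cong (ℕ._* (n ∸ 1)) (length-tabulate {n = n} (λ i → i)))

  pairs-unique : Unique pairs
  pairs-unique = Unique.filter⁺ _
    (Unique.cartesianProduct⁺ (Unique.allFin⁺ n) (Unique.allFin⁺ n))

  𝕋ℙ-unique : ∀ ⋆ → Unique (𝕋ℙ ⋆)
  𝕋ℙ-unique ⋆ = Unique.concat⁺
    (All.map⁺ (All.tabulate (λ {(s , z)} _ → Unique.map⁺ (λ { refl → refl }) (Γ-unique ⋆ s z))))
    (AllPairs.map⁺ (AllPairs.map disjoint pairs-unique))
    where
    disjoint : ∀ {x y} → x ≢ y → Disjoint (samplesOf ⋆ x) (samplesOf ⋆ y)
    disjoint x≢y (∈x , ∈y) with ∈-map⁻ _ ∈x | ∈-map⁻ _ ∈y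
    ... | _ , _ , refl | _ , _ , refl = x≢y refl

  weight-total : ∀ ⋆ → ∑ (𝕋ℙ ⋆) (weight ⋆) ≡ 1ℚ
  weight-total ⋆ = begin
    ∑ (𝕋ℙ ⋆) (weight ⋆)                            ≡⟨ ∑-concatMap (samplesOf ⋆) pairs (weight ⋆) ⟩
    ∑ pairs (λ x → ∑ (samplesOf ⋆ x) (weight ⋆))   ≡⟨ ∑-cong pairs (λ (s , z) _ → pair-total s z) ⟩
    ∑ pairs (λ _ → 1/N)                            ≡⟨ ∑-const pairs 1/N ⟩
    + length pairs / 1 ℚ.* 1/N                     ≡⟨ cong (λ k → + k / 1 ℚ.* 1/N) length-pairs ⟩
    + (n ℕ.* (n ∸ 1)) / 1 ℚ.* 1/N                  ≡⟨ m*1/m (n ℕ.* (n ∸ 1)) ⟩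
    1ℚ                                             ∎
    where
    open ≡-Reasoning
    1/N = + 1 / (n ℕ.* (n ∸ 1))

    pair-total : ∀ s z → ∑ (samplesOf ⋆ (s , z)) (weight ⋆) ≡ 1/N
    pair-total s z = begin
      ∑ (samplesOf ⋆ (s , z)) (weight ⋆)             ≡⟨ ∑-map _ (Γ ⋆ s z) (weight ⋆) ⟩
      ∑ (Γ ⋆ s z) (λ _ → 1/N ℚ.* 1/σ)                ≡⟨ ∑-const (Γ ⋆ s z) (1/N ℚ.* 1/σ) ⟩
      + σ ⋆ s z / 1 ℚ.* (1/N ℚ.* 1/σ)                ≡⟨ cong (+ σ ⋆ s z / 1 ℚ.*_) (ℚ.*-comm 1/N 1/σ) ⟩
      + σ ⋆ s z / 1 ℚ.* (1/σ ℚ.* 1/N)                ≡⟨ ℚ.*-assoc (+ σ ⋆ s z / 1) 1/σ 1/N ⟨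
      (+ σ ⋆ s z / 1 ℚ.* 1/σ) ℚ.* 1/N                ≡⟨ cong (ℚ._* 1/N) (m*1/m (σ ⋆ s z)) ⟩
      1ℚ ℚ.* 1/N                                     ≡⟨ ℚ.*-identityˡ 1/N ⟩
      1/N                                            ∎
      where 1/σ = + 1 / σ ⋆ s z

  π : Criterion → Distribution Sample
  π ⋆ = record
    { support = 𝕋ℙ ⋆
    ; unique  = 𝕋ℙ-unique ⋆
    ; mass    = weight ⋆
    ; mass≥0  = λ (s , z , _) _ → ℚ.nonNegative⁻¹ _
        {{ℚ.nonNeg*nonNeg⇒nonNeg (+ 1 / (n ℕ.* (n ∸ 1))) {{1/m≥0 (n ℕ.* (n ∸ 1))}}
            (+ 1 / σ ⋆ s z) {{1/m≥0 (σ ⋆ s z)}}}}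
    ; total   = weight-total ⋆
    }

  b̃ : W → Sample → ℚ
  b̃ v (_ , _ , tp) = 𝟙[ v ∈ⱽ? Int tp ]

{-# OPTIONS --safe #-}

-- Every sample from s to z has weight 1/(n(n-1)) · 1/σ, so the expectation is
-- 1/(n(n-1)) times the sum over s ≠ z of the proportion of optimal paths with v
-- in their interior. If v ∉ {s, z}, this proportion is σ(v)/σ, as only the first
-- and the last appearance are missing from the interior. If v ∈ {s, z}, it
-- vanishes. Passing through z before the end contradicts minimality of the length
-- or of the arrival time. Returning to s could be skipped, which shortens the path
-- without changing its arrival time, and a prefix returning to s is not foremost
-- because the trivial path arrives at time 0.
module Submission where

open import Defs
open import Relation.Binary.PropositionalEquality using (_≡_)

import Data.Fin.Properties as Fin
open import Data.Integer.Base as ℤ using (+_)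
import Data.Integer.Properties as ℤ
open import Data.List.Base using (List; []; _∷_; _++_; last; length; take; filter)
open import Data.List.Membership.Propositional using (_∈_)
open import Data.List.Membership.Propositional.Properties using (∈-++⁺ʳ)
open import Data.List.Properties using (length-++)
open import Data.List.Relation.Binary.Prefix.Heterogeneous using (Prefix; []; _∷_)
open import Data.List.Relation.Unary.Any using (here; there)
open import Data.List.Relation.Unary.Linked as Linked using (Linked; [-]; _∷_)
open import Data.Maybe.Base as Maybe using (just; maybe′)
import Data.Maybe.Properties as Maybe
open import Data.Nat.Base as ℕ using (ℕ; suc; _∸_; _<_; z≤n; s≤s; NonZero)
import Data.Nat.Properties as ℕ
open import Data.Product.Base using (_×_; _,_; proj₁; proj₂)
open import Data.Rational.Base as ℚ using (ℚ; 0ℚ; 1ℚ; _/_; toℚᵘ)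
import Data.Rational.Properties as ℚ
import Data.Rational.Unnormalised.Base as ℚᵘ
import Data.Rational.Unnormalised.Properties as ℚᵘ
open import Data.Sum.Base using (_⊎_; inj₁; inj₂; [_,_]′)
open import Function.Base using (_∘_)
open import Relation.Binary.PropositionalEquality using (_≢_; refl; sym; trans; cong; cong₂; subst; module ≡-Reasoning)
open import Relation.Nullary using (Dec; yes; no; ¬_; ¬?; contradiction)
open import Relation.Nullary.Decidable using (_×-dec_)
open import Relation.Unary using (Decidable)

private variable
  A : Set
  P Q : Set

-- Finite sums and indicators.

𝟙-yes : (P? : Dec P) → P → 𝟙[ P? ] ≡ 1ℚ
𝟙-yes (yes _) _ = refl
𝟙-yes (no ¬p) p = contradiction p ¬p

𝟙-no : (P? : Dec P) → ¬ P → 𝟙[ P? ] ≡ 0ℚ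
𝟙-no (yes p) ¬p = contradiction p ¬p
𝟙-no (no _)  _  = refl

𝟙-cong : (P? : Dec P) (Q? : Dec Q) → (P → Q) → (Q → P) → 𝟙[ P? ] ≡ 𝟙[ Q? ]
𝟙-cong P? (yes q) _   Q⇒P = 𝟙-yes P? (Q⇒P q)
𝟙-cong P? (no ¬q) P⇒Q _   = 𝟙-no P? (¬q ∘ P⇒Q)

∑-zero : ∀ (xs : List A) {f : A → ℚ} → (∀ x → x ∈ xs → f x ≡ 0ℚ) → ∑ xs f ≡ 0ℚ
∑-zero xs f≡0 = trans (∑-cong xs f≡0) (trans (∑-const xs 0ℚ) (ℚ.*-zeroʳ (+ length xs / 1)))

∑-*ˡ : ∀ (xs : List A) c (f : A → ℚ) → ∑ xs (λ x → c ℚ.* f x) ≡ c ℚ.* ∑ xs f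
∑-*ˡ []       c f = sym (ℚ.*-zeroʳ c)
∑-*ˡ (x ∷ xs) c f =
  trans (cong (c ℚ.* f x ℚ.+_) (∑-*ˡ xs c f)) (sym (ℚ.*-distribˡ-+ c (f x) (∑ xs f)))

∑-𝟙 : ∀ {P : A → Set} (P? : Decidable P) xs →
      ∑ xs (λ x → 𝟙[ P? x ]) ≡ + length (filter P? xs) / 1
∑-𝟙 P? []       = refl
∑-𝟙 P? (x ∷ xs) with P? x
... | yes _ = trans (cong (1ℚ ℚ.+_) (∑-𝟙 P? xs)) (sym (suc/1 (length (filter P? xs))))
... | no  _ = trans (ℚ.+-identityˡ _) (∑-𝟙 P? xs)

-- Two integrands appear because they agree only on `P`: when `v` is an endpoint, `σ[ v ]` counts
-- every nonempty path, whereas the interior indicator vanishes.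
∑-filter : ∀ {P : A → Set} (P? : Decidable P) xs {f g : A → ℚ} →
           (∀ x → x ∈ xs → P x → f x ≡ g x) → (∀ x → x ∈ xs → ¬ P x → f x ≡ 0ℚ) →
           ∑ xs f ≡ ∑ (filter P? xs) g
∑-filter P? []       f≡g f≡0 = refl
∑-filter P? (x ∷ xs) f≡g f≡0
  with P? x | ∑-filter P? xs (λ y → f≡g y ∘ there) (λ y → f≡0 y ∘ there)
... | yes p | eq = cong₂ ℚ._+_ (f≡g x (here refl) p) eq
... | no ¬p | eq = trans (cong₂ ℚ._+_ (f≡0 x (here refl) ¬p) eq) (ℚ.+-identityˡ _)

-- `_/_` reduces by the gcd, so the identity is checked on unreduced fractions, where it is the
-- cross-multiplication `(1 * k) * m = k * (m * 1)`. As `mkℚᵘ` stores the denominator minus one, `m`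
-- is matched as a successor.
1/m*k : ∀ k m .{{_ : NonZero m}} → (+ 1 / m) ℚ.* (+ k / 1) ≡ + k / m
1/m*k k m@(suc m-1) = ℚ.toℚᵘ-injective (begin-equality
  toℚᵘ ((+ 1 / m) ℚ.* (+ k / 1))              ≃⟨ ℚ.toℚᵘ-homo-* (+ 1 / m) (+ k / 1) ⟩
  toℚᵘ (+ 1 / m) ℚᵘ.* toℚᵘ (+ k / 1)          ≃⟨ ℚᵘ.*-cong (ℚ.toℚᵘ-fromℚᵘ (ℚᵘ.mkℚᵘ (+ 1) m-1)) (ℚ.toℚᵘ-fromℚᵘ (ℚᵘ.mkℚᵘ (+ k) 0)) ⟩
  ℚᵘ.mkℚᵘ (+ 1) m-1 ℚᵘ.* ℚᵘ.mkℚᵘ (+ k) 0      ≃⟨ ℚᵘ.*≡* (cong₂ ℤ._*_ (ℤ.*-identityˡ (+ k)) (cong +_ (sym (ℕ.*-identityʳ m)))) ⟩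
  ℚᵘ.mkℚᵘ (+ k) m-1                           ≃⟨ ℚ.toℚᵘ-fromℚᵘ (ℚᵘ.mkℚᵘ (+ k) m-1) ⟨
  toℚᵘ (+ k / m)                              ∎)
  where open ℚᵘ.≤-Reasoning

-- Lists cut at an interior position.

last-++-∷ : ∀ (xs : List A) y ys → last (xs ++ y ∷ ys) ≡ last (y ∷ ys)
last-++-∷ []           y ys = refl
last-++-∷ (_ ∷ [])     y ys = refl
last-++-∷ (_ ∷ x ∷ xs) y ys = last-++-∷ (x ∷ xs) y ys

linked-++⁻ˡ : ∀ {R : A → A → Set} xs {y ys} → Linked R (xs ++ y ∷ ys) → Linked R (xs ++ y ∷ [])
linked-++⁻ˡ []           _        = [-]
linked-++⁻ˡ (_ ∷ [])     (r ∷ _)  = r ∷ [-]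
linked-++⁻ˡ (_ ∷ x ∷ xs) (r ∷ rs) = r ∷ linked-++⁻ˡ (x ∷ xs) rs

linked-++⁻ʳ : ∀ {R : A → A → Set} xs {ys} → Linked R (xs ++ ys) → Linked R ys
linked-++⁻ʳ []       rs = rs
linked-++⁻ʳ (_ ∷ xs) rs = linked-++⁻ʳ xs (Linked.tail rs)

prefix-++-∷ : ∀ (xs : List A) {y ys} → Prefix _≡_ (xs ++ y ∷ []) (xs ++ y ∷ ys)
prefix-++-∷ []       = refl ∷ []
prefix-++-∷ (_ ∷ xs) = refl ∷ prefix-++-∷ xs

-- Splitting at the occurrence exposes the pieces that `truncate` and `shortcut` recombine; `a` and
-- `b` keep it away from both ends.
data Inside (x : A) : List A → Set where
  inside : ∀ a as b bs → Inside x (a ∷ as ++ x ∷ b ∷ bs)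

inside⇒∈ : ∀ {x : A} {xs} → Inside x xs → x ∈ xs
inside⇒∈ (inside a as b bs) = there (∈-++⁺ʳ as (here refl))

inside-∷ : ∀ {x a : A} {xs} → Inside x xs → Inside x (a ∷ xs)
inside-∷ (inside a as b bs) = inside _ (a ∷ as) b bs

-- On `a ∷ b ∷ as`, `Int G` computes to `take (length as) (b ∷ as)`; here and in `init⁺` the
-- induction runs on this form.
init⁻ : ∀ {x a : A} as b → x ∈ take (length as) (b ∷ as) → Inside x (a ∷ b ∷ as)
init⁻ (c ∷ cs) b (here refl) = inside _ [] c cs
init⁻ (c ∷ cs) b (there x∈)  = inside-∷ (init⁻ cs c x∈)

init⁺ : ∀ {x : A} as b → x ∈ b ∷ as → x ∈ take (length as) (b ∷ as) ⊎ last (b ∷ as) ≡ just x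
init⁺ []       b (here refl) = inj₂ refl
init⁺ (c ∷ cs) b (here refl) = inj₁ (here refl)
init⁺ (c ∷ cs) b (there x∈)  = [ inj₁ ∘ there , inj₂ ]′ (init⁺ cs c x∈)

module _ (G : TemporalGraph) where
  open TemporalGraph G using (V; Appearance)

  private variable
    s z v : V
    t : ℕ
    a b x : Appearance
    as bs tp : List Appearance

  -- Cutting and shortening temporal paths.

  Int⇒inside : ∀ tp → x ∈ Int G tp → Inside x tp
  Int⇒inside (a ∷ b ∷ as) x∈ = init⁻ as b x∈

  ∈⇒Int : IsTemporalPath G s z tp → v ≢ s → v ≢ z → (v , t) ∈ tp → (v , t) ∈ Int G tp
  ∈⇒Int {tp = _ ∷ _}      (refl , _)       v≢s _   (here refl) = contradiction refl v≢s
  ∈⇒Int {tp = _ ∷ b ∷ as} (_ , _ , last≡z) _   v≢z (there v∈) with init⁺ as b v∈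
  ... | inj₁ v∈init = v∈init
  ... | inj₂ last≡v = contradiction
    (Maybe.just-injective (trans (sym (cong (Maybe.map proj₁) last≡v)) last≡z)) v≢z

  arrival-++-∷ : ∀ as b bs → arrival G (as ++ b ∷ bs) ≡ arrival G (b ∷ bs)
  arrival-++-∷ as b bs = cong (maybe′ proj₂ 0) (last-++-∷ as b bs)

  time-increasing : ∀ as → Linked (Step G) (a ∷ as ++ b ∷ bs) → proj₂ a < proj₂ b
  time-increasing []       ((a<b , _) ∷ _) = a<b
  time-increasing (_ ∷ as) ((a<c , _) ∷ l) = ℕ.<-trans a<c (time-increasing as l)

  time<arrival : Linked (Step G) (a ∷ b ∷ bs) → proj₂ a < arrival G (b ∷ bs)
  time<arrival ((a<b , _) ∷ [-])       = a<b
  time<arrival ((a<b , _) ∷ l@(_ ∷ _)) = ℕ.<-trans a<b (time<arrival l)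

  -- For `v = z` the result competes with the whole path; for `v = s` it is a prefix returning to
  -- the source.
  truncate : ∀ as → IsTemporalPath G s z (a ∷ as ++ (v , t) ∷ bs) →
             IsTemporalPath G s v (a ∷ as ++ (v , t) ∷ [])
  truncate {a = a} as (hd , l , _) =
    hd , linked-++⁻ˡ (a ∷ as) l , cong (Maybe.map proj₁) (last-++-∷ (a ∷ as) _ [])

  truncate-earlier : ∀ as → IsTemporalPath G s z (a ∷ as ++ (v , t) ∷ b ∷ bs) →
                     arrival G (a ∷ as ++ (v , t) ∷ []) < arrival G (a ∷ as ++ (v , t) ∷ b ∷ bs)
  truncate-earlier {a = a} {v = v} {t = t} {b = b} {bs = bs} as (_ , l , _) = begin-strict
    arrival G (a ∷ as ++ (v , t) ∷ [])      ≡⟨ arrival-++-∷ (a ∷ as) (v , t) [] ⟩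
    t                                       <⟨ time<arrival (linked-++⁻ʳ (a ∷ as) l) ⟩
    arrival G (b ∷ bs)                      ≡⟨ arrival-++-∷ (a ∷ as) (v , t) (b ∷ bs) ⟨
    arrival G (a ∷ as ++ (v , t) ∷ b ∷ bs)  ∎
    where open ℕ.≤-Reasoning

  truncate-shorter : ∀ a as → pathLength G (a ∷ as ++ x ∷ []) < pathLength G (a ∷ as ++ x ∷ b ∷ bs)
  truncate-shorter {x} {b} {bs} _ as = begin-strict
    length (as ++ x ∷ [])                 ≡⟨ length-++ as ⟩
    length as ℕ.+ 1                       <⟨ ℕ.+-monoʳ-< (length as) (s≤s (s≤s z≤n)) ⟩
    length as ℕ.+ length (x ∷ b ∷ bs)     ≡⟨ length-++ as ⟨
    length (as ++ x ∷ b ∷ bs)             ∎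
    where open ℕ.≤-Reasoning

  -- The time of an edge is recorded at the appearance it leads to, so the step that leaves the
  -- revisited `s` after time `t` is also valid from `(s , 0)`.
  shortcut : ∀ as → IsTemporalPath G s z (a ∷ as ++ (s , t) ∷ b ∷ bs) →
             IsTemporalPath G s z ((s , 0) ∷ b ∷ bs)
  shortcut {a = a} as (_ , l , last≡z) with linked-++⁻ʳ (a ∷ as) l
  ... | (t<t′ , e∈) ∷ l′ = refl , (ℕ.≤-<-trans z≤n t<t′ , e∈) ∷ l′ ,
    trans (sym (cong (Maybe.map proj₁) (last-++-∷ (a ∷ as) _ _))) last≡z

  shortcut-shorter : ∀ s a as → pathLength G ((s , 0) ∷ b ∷ bs) < pathLength G (a ∷ as ++ x ∷ b ∷ bs)
  shortcut-shorter {b} {bs} {x} _ _ as = begin-strict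
    -- The strict inequality unfolds to `length (x ∷ b ∷ bs)` being at most the right-hand side,
    -- which holds even for empty `as`.
    length (b ∷ bs)                       <⟨ ℕ.m≤n+m (length (x ∷ b ∷ bs)) (length as) ⟩
    length as ℕ.+ length (x ∷ b ∷ bs)     ≡⟨ length-++ as ⟨
    length (as ++ x ∷ b ∷ bs)             ∎
    where open ℕ.≤-Reasoning

  -- Endpoints are not interior to optimal paths.

  foremost-avoids-target : Foremost G s z tp → ¬ Inside (z , t) tp
  foremost-avoids-target (path , min) (inside a as b bs) =
    ℕ.<⇒≱ (truncate-earlier as path) (min _ (truncate as path))

  -- Truncation at `z` lowers both length and arrival time; both foremost criteria reduce to the
  -- bound on arrival.
  optimal-avoids-target : ∀ ⋆ → Optimal G ⋆ s z tp → ¬ Inside (z , t) tp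
  optimal-avoids-target shortest (path , min) (inside a as b bs) =
    ℕ.<⇒≱ (truncate-shorter a as) (min _ (truncate as path))
  optimal-avoids-target shortestForemost = foremost-avoids-target ∘ proj₁
  optimal-avoids-target prefixForemost   = foremost-avoids-target ∘ proj₁

  optimal-avoids-source : ∀ ⋆ → Optimal G ⋆ s z tp → ¬ Inside (s , t) tp
  optimal-avoids-source {s} shortest (path , min) (inside a as b bs) =
    ℕ.<⇒≱ (shortcut-shorter s a as) (min _ (shortcut as path))
  optimal-avoids-source {s} {t = t} shortestForemost ((path , min) , len-min) (inside a as b bs) =
    -- The shortcut ends in the same appearance as the original path, so it inherits the bound `min`
    -- and competes in `len-min`.
    ℕ.<⇒≱ (shortcut-shorter s a as) (len-min _ (shortcut as path , λ tp′ path′ →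
      subst (ℕ._≤ arrival G tp′) (arrival-++-∷ (a ∷ as) (s , t) (b ∷ bs)) (min tp′ path′)))
  optimal-avoids-source {s} {t = t} prefixForemost ((path@(_ , l , _) , _) , pre) (inside a as b bs) =
    ℕ.n≮0 (begin-strict
      proj₂ a                             <⟨ time-increasing as l ⟩
      t                                   ≡⟨ arrival-++-∷ (a ∷ as) (s , t) [] ⟨
      -- `pre` makes the prefix ending at the return foremost from `s` to `s`, where the trivial
      -- path is a competitor.
      arrival G (a ∷ as ++ (s , t) ∷ [])  ≤⟨ proj₂ (pre s _ (truncate as path) (prefix-++-∷ (a ∷ as))) ((s , 0) ∷ []) (refl , [-] , refl) ⟩
      0                                   ∎)
    where open ℕ.≤-Reasoning

  -- From optimal paths to counts over `Γ`.

  Γ-avoids-endpoints : ∀ ⋆ s z → tp ∈ Γ G ⋆ s z → (v ≡ s) ⊎ (v ≡ z) → ¬ (_∈ⱽ_ G v (Int G tp))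
  Γ-avoids-endpoints {tp} ⋆ s z tp∈ v≡ (t , v∈) with ∈-Γ⁻ G ⋆ s z tp∈ | v≡
  ... | inj₁ opt        | inj₁ refl = optimal-avoids-source ⋆ opt (Int⇒inside tp v∈)
  ... | inj₁ opt        | inj₂ refl = optimal-avoids-target ⋆ opt (Int⇒inside tp v∈)
  -- `[]` stands for the empty path of an unreachable pair; its `Int` has no member.
  Γ-avoids-endpoints ⋆ s z tp∈ v≡ (t , ()) | inj₂ (_ , refl) | _

  Γ-visits⇒interior : ∀ ⋆ s z → tp ∈ Γ G ⋆ s z → v ≢ s → v ≢ z →
                      _∈ⱽ_ G v tp → _∈ⱽ_ G v (Int G tp)
  Γ-visits⇒interior ⋆ s z tp∈ v≢s v≢z (t , v∈) with ∈-Γ⁻ G ⋆ s z tp∈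
  ... | inj₁ opt = t , ∈⇒Int (optimal-path G ⋆ opt) v≢s v≢z v∈
  Γ-visits⇒interior ⋆ s z tp∈ v≢s v≢z (t , ()) | inj₂ (_ , refl)

  -- `b̃` tests `Int G tp` while `σ[_]` tests all of `tp`; the two tests agree away from the
  -- endpoints.
  ∑-interior-visits : ∀ ⋆ s z → v ≢ s → v ≢ z →
    ∑ (Γ G ⋆ s z) (λ tp → b̃ G v (s , z , tp)) ≡ + σ[_] G v ⋆ s z / 1
  ∑-interior-visits {v} ⋆ s z v≢s v≢z = trans
    (∑-cong (Γ G ⋆ s z) λ tp tp∈ → 𝟙-cong (_∈ⱽ?_ G v (Int G tp)) (_∈ⱽ?_ G v tp)
      (λ (t , v∈) → t , inside⇒∈ (Int⇒inside tp v∈))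
      (Γ-visits⇒interior ⋆ s z tp∈ v≢s v≢z))
    (∑-𝟙 (_∈ⱽ?_ G v) (Γ G ⋆ s z))

  ∑-interior-endpoint : ∀ ⋆ s z → (v ≡ s) ⊎ (v ≡ z) →
    ∑ (Γ G ⋆ s z) (λ tp → b̃ G v (s , z , tp)) ≡ 0ℚ
  ∑-interior-endpoint {v} ⋆ s z v≡ = ∑-zero (Γ G ⋆ s z) λ tp tp∈ →
    𝟙-no (_∈ⱽ?_ G v (Int G tp)) (Γ-avoids-endpoints ⋆ s z tp∈ v≡)

lemma7 : (G : TemporalGraph) (⋆ : Criterion) (v : TemporalGraph.V G) →
    𝔼 (π G ⋆) (b̃ G v) ≡ betweenness G ⋆ v
lemma7 G ⋆ v = begin
  ∑ (𝕋ℙ G ⋆) f                                    ≡⟨ ∑-concatMap (samplesOf G ⋆) (pairs G) f ⟩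
  ∑ (pairs G) (λ p → ∑ (samplesOf G ⋆ p) f)       ≡⟨ ∑-cong (pairs G) (λ (s , z) _ → pair-sum s z) ⟩
  ∑ (pairs G) (λ p → 1/N ℚ.* ratio p)             ≡⟨ ∑-*ˡ (pairs G) 1/N ratio ⟩
  1/N ℚ.* ∑ (pairs G) ratio                       ≡⟨ cong (1/N ℚ.*_) (∑-filter avoids? (pairs G) (λ (s , z) _ → ratio-avoids s z) (λ (s , z) _ → ratio-meets s z)) ⟩
  betweenness G ⋆ v                               ∎
  where
  open ≡-Reasoning
  open TemporalGraph G using (n; V)

  f : Sample G → ℚ
  f x = weight G ⋆ x ℚ.* b̃ G v x

  1/N = (+ 1 / (n ℕ.* (n ∸ 1))) {{n[n-1]-nonZero G}}

  1/σ : V → V → ℚ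
  1/σ s z = (+ 1 / σ G ⋆ s z) {{σ-nonZero G}}

  visits : V → V → ℚ
  visits s z = ∑ (Γ G ⋆ s z) (λ tp → b̃ G v (s , z , tp))

  -- The conditional probability that `v` is interior, given the endpoints of the sample.
  ratio : V × V → ℚ
  ratio (s , z) = 1/σ s z ℚ.* visits s z

  avoids? : Decidable (λ ((s , z) : V × V) → s ≢ v × z ≢ v)
  avoids? (s , z) = ¬? (s Fin.≟ v) ×-dec ¬? (z Fin.≟ v)

  pair-sum : ∀ s z → ∑ (samplesOf G ⋆ (s , z)) f ≡ 1/N ℚ.* ratio (s , z)
  pair-sum s z = begin
    ∑ (samplesOf G ⋆ (s , z)) f                                          ≡⟨ ∑-map _ (Γ G ⋆ s z) f ⟩
    ∑ (Γ G ⋆ s z) (λ tp → (1/N ℚ.* 1/σ s z) ℚ.* b̃ G v (s , z , tp))     ≡⟨ ∑-*ˡ (Γ G ⋆ s z) (1/N ℚ.* 1/σ s z) _ ⟩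
    (1/N ℚ.* 1/σ s z) ℚ.* visits s z                                     ≡⟨ ℚ.*-assoc 1/N (1/σ s z) (visits s z) ⟩
    1/N ℚ.* ratio (s , z)                                                ∎

  ratio-avoids : ∀ s z → s ≢ v × z ≢ v →
                 ratio (s , z) ≡ (+ σ[_] G v ⋆ s z / σ G ⋆ s z) {{σ-nonZero G}}
  ratio-avoids s z (s≢v , z≢v) = trans
    (cong (1/σ s z ℚ.*_) (∑-interior-visits G ⋆ s z (s≢v ∘ sym) (z≢v ∘ sym)))
    (1/m*k (σ[_] G v ⋆ s z) (σ G ⋆ s z) {{σ-nonZero G}})

  ratio-meets : ∀ s z → ¬ (s ≢ v × z ≢ v) → ratio (s , z) ≡ 0ℚ
  ratio-meets s z meets = trans
    (cong (1/σ s z ℚ.*_) (∑-interior-endpoint G ⋆ s z endpoint)) (ℚ.*-zeroʳ (1/σ s z))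
    where
    endpoint : (v ≡ s) ⊎ (v ≡ z)
    endpoint with v Fin.≟ s | v Fin.≟ z
    ... | yes v≡s | _       = inj₁ v≡s
    ... | no  _   | yes v≡z = inj₂ v≡z
    ... | no  v≢s | no  v≢z = contradiction (v≢s ∘ sym , v≢z ∘ sym) meets
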